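{- For every integer $k\ge 4$, $\gamma(k)\le (2k-2)\,\gamma(k-1)+6$.
   Context: A word is a finite sequence of letters. An occurrence of a word $C$ as a subsequence of a word $S$ is an increasing sequence of positions $i_0<\cdots<i_{|C|-1}$ of $S$ with $S[i_j]=C[j]$. $C$ is an s-cover of $S$ if every position of $S$ lies in some occurrence of $C$ as a subsequence of $S$. An s-cover $C$ of $S$ is non-trivial if $|C|<|S|$; $S$ is s-primitive if it has no non-trivial s-cover. $\gamma(k)$ denotes the length of a longest s-primitive word over an alphabet of size $k$. -}

module Defs where

open import Data.Nat using (ℕ; _≤_; _<_)
open import Data.Fin using (Fin)
import Data.Fin as F
open import Data.List using (List; length; lookup)
open import Data.Product using (Σ; ∃; _×_)
open import Relation.Nullary using (¬_)
open import Relation.Binary.PropositionalEquality using (_≡_)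

record Occurrence {A : Set} (C S : List A) : Set where
  field
    pos     : Fin (length C) → Fin (length S)
    incr    : ∀ i j → i F.< j → pos i F.< pos j
    letters : ∀ i → lookup S (pos i) ≡ lookup C i

SCover : {A : Set} → List A → List A → Set
SCover C S = ∀ (p : Fin (length S)) →
  Σ (Occurrence C S) λ o → ∃ λ i → Occurrence.pos o i ≡ p

SPrimitive : {A : Set} → List A → Set
SPrimitive {A} S = ¬ (Σ (List A) λ C → SCover C S × length C < length S)

IsGamma : ℕ → ℕ → Set
IsGamma k g =
  (Σ (List (Fin k)) λ w → SPrimitive w × length w ≡ g) ×
  (∀ (w : List (Fin k)) → SPrimitive w → length w ≤ g)

{-# OPTIONS --safe #-}
-- Let π list the letters of S by first occurrence and σ by last occurrence, and let C = πσ, contracted when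
-- π ends with the first letter of σ. A position p with letter a is covered unless the part after p omits
-- π_{>a}σ and the part before p omits πσ_{<a}. A word w without repeated letters can only be omitted by an
-- s-primitive word of length at most |w|γ(k-1): cut greedily into |w| pieces, each missing one letter. Also,
-- the shortest suffix containing σ costs one more γ(k-1), and likewise π on the other side. Hence
-- |S| ≤ (|π_{>a}| + |σ_{<a}| + 2)γ(k-1), which is at most (2k-2)γ(k-1) unless a letter among the first two of π
-- is also among the last two of σ. Since s-primitive words are square-free and their factors are s-primitive,
-- deleting at most six letters from the two ends removes this exception.
module Submission where

open import Defs
open import Data.Nat using (ℕ; _≤_; _+_; _*_; _∸_)
open import Data.Nat using (zero; suc; _<_; _⊔_; z≤n; s≤s; _≤?_)
open import Data.Nat.Properties
open import Data.Fin using (Fin; zero; suc; toℕ; punchIn; punchOut)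
import Data.Fin as F
import Data.Fin.Properties as F
open import Data.List using (List; []; _∷_; [_]; _++_; length; lookup; map; reverse;
  take; drop; filter; deduplicate; InitLast; initLast; _∷ʳ′_)
open import Data.List.Properties
import Data.List.Membership.DecPropositional as DecMembership
open import Data.List.Membership.Propositional using (_∈_; _∉_)
open import Data.List.Membership.Propositional.Properties
  using (∈-filter⁻; ∈-deduplicate⁺; ∈-∃++; ∈-lookup; ∈-++⁻; ∈-insert)
import Data.List.Relation.Binary.Sublist.DecPropositional as DecSublist
open import Data.List.Relation.Binary.Sublist.Propositional
  using (_⊆_; []; _∷_; _∷ʳ_; minimum; ⊆-refl; ⊆-trans)
open import Data.List.Relation.Binary.Sublist.Propositional.Properties
  using (++⁺; ++⁺ˡ; ++⁺ʳ; map⁺; reverse⁺; reverse⁻; ∷ʳ⁻; All-resp-⊆)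
open import Data.List.Relation.Unary.All as All using (All; []; _∷_)
open import Data.List.Relation.Unary.AllPairs using ([]; _∷_)
open import Data.List.Relation.Unary.Any using (here; there)
import Data.List.Relation.Unary.Any.Properties as Any
import Data.List.Relation.Unary.Unique.DecPropositional.Properties as DecUnique
open import Data.List.Relation.Unary.Unique.Propositional using (Unique)
import Data.List.Relation.Unary.Unique.Propositional.Properties as Unique
open import Data.Product using (Σ; ∃; ∃₂; _×_; _,_; proj₁; proj₂)
open import Data.Sum using (_⊎_; inj₁; inj₂)
open import Data.Empty using (⊥; ⊥-elim)
open import Function using (_∘_)
open import Relation.Nullary using (¬_; ¬?; yes; no)
open import Relation.Unary using (Decidable)
open import Relation.Binary.Definitions using (DecidableEquality)
open import Relation.Binary.PropositionalEquality hiding ([_])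

private variable
  A B : Set
  C S T U V W : List A
  s t : List A
  a b c d e f b′ c′ d′ e′ p q p′ q′ x y : A
  i : ℕ

-- Covers by splittings

-- An occurrence that uses the displayed `a` of `U ++ a ∷ V`, encoded by cutting `C` at the letter
-- placed there. Covering thus becomes a matter of two sublist relations, without positions.
Through : List A → List A → A → List A → Set
Through C U a V = ∃₂ λ C₁ C₂ → C ≡ C₁ ++ a ∷ C₂ × C₁ ⊆ U × C₂ ⊆ V

Cover : List A → List A → Set
Cover C S = ∀ {U a V} → S ≡ U ++ a ∷ V → Through C U a V

splitAt : (S : List A) (p : Fin (length S)) →
  ∃₂ λ U V → S ≡ U ++ lookup S p ∷ V × toℕ p ≡ length U
splitAt (s ∷ S) zero = [] , S , refl , refl
splitAt (s ∷ S) (suc p) with U , V , eq , e ← splitAt S p = s ∷ U , V , cong (s ∷_) eq , cong suc e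

position : (U : List A) → S ≡ U ++ a ∷ V → ∃ λ (p : Fin (length S)) → toℕ p ≡ length U
position [] refl = zero , refl
position (u ∷ U) refl with p , e ← position U refl = suc p , cong suc e

open Occurrence

empty-occurrence : Occurrence [] S
empty-occurrence = record { pos = λ () ; incr = λ () ; letters = λ () }

skip : Occurrence C S → Occurrence C (a ∷ S)
skip o = record { pos = suc ∘ pos o ; incr = λ i j i<j → s≤s (incr o i j i<j) ; letters = letters o }

keep : Occurrence C S → Occurrence (a ∷ C) (a ∷ S)
keep {C = C} {S = S} {a = a} o = record { pos = pos′ ; incr = incr′ ; letters = letters′ }
  where
  pos′ : Fin (suc (length C)) → Fin (suc (length S))
  pos′ zero = zero
  pos′ (suc i) = suc (pos o i)
  incr′ : ∀ i j → i F.< j → pos′ i F.< pos′ j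
  incr′ zero (suc j) _ = s≤s z≤n
  incr′ (suc i) (suc j) (s≤s i<j) = s≤s (incr o i j i<j)
  letters′ : ∀ i → lookup (a ∷ S) (pos′ i) ≡ lookup (a ∷ C) i
  letters′ zero = refl
  letters′ (suc i) = letters o i

occurrence : C ⊆ S → Occurrence C S
occurrence [] = empty-occurrence
occurrence (_ ∷ʳ τ) = skip (occurrence τ)
occurrence (refl ∷ τ) = keep (occurrence τ)

occurrence-through : {U : List A} {C₁ C₂ : List A} → C₁ ⊆ U → C₂ ⊆ V →
  Σ (Occurrence (C₁ ++ a ∷ C₂) (U ++ a ∷ V)) λ o → ∃ λ i → toℕ (pos o i) ≡ length U
occurrence-through [] τ = keep (occurrence τ) , zero , refl
occurrence-through (_ ∷ʳ σ) τ with o , i , e ← occurrence-through σ τ = skip o , i , cong suc e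
occurrence-through (refl ∷ σ) τ with o , i , e ← occurrence-through σ τ = keep o , suc i , cong suc e

unskip : (o : Occurrence C (a ∷ S)) → (∀ i → zero ≢ pos o i) →
  Σ (Occurrence C S) λ o′ → ∀ i → pos o i ≡ suc (pos o′ i)
unskip {C = C} {a = a} {S = S} o pos>0 = record
  { pos = pos′
  ; incr = λ i j i<j → ≤-pred (subst₂ F._<_ (eq i) (eq j) (incr o i j i<j))
  ; letters = λ i → trans (cong (lookup (a ∷ S)) (sym (eq i))) (letters o i) } , eq
  where
  pos′ : Fin (length C) → Fin (length S)
  pos′ i = punchOut (pos>0 i)
  eq : ∀ i → pos o i ≡ suc (pos′ i)
  eq i = sym (F.punchIn-punchOut (pos>0 i))

unkeep : Occurrence (c ∷ C) S → Occurrence C S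
unkeep o = record
  { pos = pos o ∘ suc ; incr = λ i j i<j → incr o (suc i) (suc j) (s≤s i<j) ; letters = letters o ∘ suc }

later>0 : (o : Occurrence (c ∷ C) (a ∷ S)) → ∀ i → zero ≢ pos o (suc i)
later>0 o i 0≡p = n≮0 (subst (λ p → toℕ (pos o zero) < toℕ p) (sym 0≡p) (incr o zero (suc i) (s≤s z≤n)))

all>0 : (o : Occurrence (c ∷ C) (a ∷ S)) → ∀ {p} → pos o zero ≡ suc p → ∀ i → zero ≢ pos o i
all>0 o eq zero 0≡p with () ← trans 0≡p eq
all>0 o eq (suc i) = later>0 o i

occurrence⇒⊆ : (S : List A) → Occurrence C S → C ⊆ S
occurrence⇒⊆ {C = []} S o = minimum S
occurrence⇒⊆ {C = c ∷ C} [] o with () ← pos o zero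
occurrence⇒⊆ {C = c ∷ C} (s ∷ S) o with pos o zero in eq
... | zero = sym (trans (cong (lookup (s ∷ S)) (sym eq)) (letters o zero))
             ∷ occurrence⇒⊆ S (proj₁ (unskip (unkeep o) (later>0 o)))
... | suc p = s ∷ʳ occurrence⇒⊆ S (proj₁ (unskip o (all>0 o eq)))

through : (U : List A) (o : Occurrence C (U ++ a ∷ V)) → ∀ i → toℕ (pos o i) ≡ length U → Through C U a V
through {C = c ∷ C} {V = V} [] o zero e with pos o zero in eq
... | zero = [] , C , cong (_∷ C) (sym (trans (cong (lookup (_ ∷ _)) (sym eq)) (letters o zero))) , [] ,
             occurrence⇒⊆ V (proj₁ (unskip (unkeep o) (later>0 o)))
through {C = c ∷ C} [] o (suc i) e = ⊥-elim (later>0 o i (sym (F.toℕ-injective e)))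
through {C = c ∷ C} (u ∷ U) o i e with pos o zero in eq
... | suc p
    with o′ , eq′ ← unskip o (all>0 o eq)
    with C₁ , C₂ , eqC , σ , τ ← through U o′ i (suc-injective (trans (cong toℕ (sym (eq′ i))) e))
    = C₁ , C₂ , eqC , u ∷ʳ σ , τ
through {C = c ∷ C} (u ∷ U) o zero e | zero with () ← trans (sym (cong toℕ eq)) e
through {C = c ∷ C} (u ∷ U) o (suc i) e | zero
    with o′ , eq′ ← unskip (unkeep o) (later>0 o)
    with C₁ , C₂ , eqC , σ , τ ← through U o′ i (suc-injective (trans (cong toℕ (sym (eq′ i))) e))
    = c ∷ C₁ , C₂ , cong (c ∷_) eqC ,
      sym (trans (cong (lookup (_ ∷ _)) (sym eq)) (letters o zero)) ∷ σ , τ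

SCover⇒Cover : SCover C S → Cover C S
SCover⇒Cover cov {U} refl with p , e ← position U refl with o , i , refl ← cov p = through U o i e

Cover⇒SCover : Cover C S → SCover C S
Cover⇒SCover {S = S} cov p with U , V , eq , e ← splitAt S p = lemma (lookup S p) eq e (cov eq)
  where
  lemma : ∀ {C S : List _} {U V p} a → S ≡ U ++ a ∷ V → toℕ p ≡ length U → Through C U a V →
    Σ (Occurrence C S) λ o → ∃ λ i → pos o i ≡ p
  lemma _ refl e (C₁ , C₂ , refl , σ , τ) with o , i , e′ ← occurrence-through σ τ
    = o , i , F.toℕ-injective (trans e′ (sym e))

¬primitive : Cover C S → length C < length S → ¬ SPrimitive S
¬primitive cov C<S prim = prim (_ , Cover⇒SCover cov , C<S)

-- s-primitive words under factors, reversal and renaming of letters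

++-split : (S : List A) → S ++ T ≡ U ++ a ∷ V →
  (∃ λ V′ → S ≡ U ++ a ∷ V′ × V ≡ V′ ++ T) ⊎ (∃ λ U′ → U ≡ S ++ U′ × T ≡ U′ ++ a ∷ V)
++-split {U = U} [] eq = inj₂ (U , refl , eq)
++-split {U = []} (s ∷ S) refl = inj₁ (S , refl , refl)
++-split {U = u ∷ U} (s ∷ S) eq with refl , eq′ ← ∷-injective eq with ++-split S eq′
... | inj₁ (V′ , refl , refl) = inj₁ (V′ , refl , refl)
... | inj₂ (U′ , refl , refl) = inj₂ (U′ , refl , refl)

-- Any covered position yields an occurrence. The strict inequality makes `S` non-empty, so a first
-- position exists; the empty word is covered vacuously by every word.
cover⇒⊆ : length C < length S → Cover C S → C ⊆ S
cover⇒⊆ {S = s ∷ S} _ cov with [] , _ , refl , [] , τ ← cov {U = []} refl = refl ∷ τ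

-- A non-trivial cover `C` of `S` would extend to `C ++ T`: for a position in `S` append `T` to the
-- occurrence of `C`, and for one in `T` put any occurrence of `C` in `S` in front of `T`.
primitive-++ˡ : (S T : List A) → SPrimitive (S ++ T) → SPrimitive S
primitive-++ˡ S T prim (C , scov , C<S) = ¬primitive cov′
  (subst₂ _<_ (sym (length-++ C)) (sym (length-++ S)) (+-monoˡ-< (length T) C<S)) prim
  where
  cov = SCover⇒Cover scov
  cov′ : Cover (C ++ T) (S ++ T)
  cov′ eq with ++-split S eq
  ... | inj₁ (V′ , eqS , refl) with C₁ , C₂ , refl , σ , τ ← cov eqS
      = C₁ , C₂ ++ T , ++-assoc C₁ _ T , σ , ++⁺ τ ⊆-refl
  ... | inj₂ (U′ , refl , refl)
      = C ++ U′ , _ , sym (++-assoc C U′ _) , ++⁺ (cover⇒⊆ C<S cov) ⊆-refl , ⊆-refl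

primitive-++ʳ : (S T : List A) → SPrimitive (S ++ T) → SPrimitive T
primitive-++ʳ S T prim (C , scov , C<T) = ¬primitive cov′
  (subst₂ _<_ (sym (length-++ S)) (sym (length-++ S)) (+-monoʳ-< (length S) C<T)) prim
  where
  cov = SCover⇒Cover scov
  cov′ : Cover (S ++ C) (S ++ T)
  cov′ eq with ++-split S eq
  ... | inj₁ (V′ , refl , refl) = _ , V′ ++ C , ++-assoc _ (_ ∷ V′) C , ⊆-refl , ++⁺ ⊆-refl (cover⇒⊆ C<T cov)
  ... | inj₂ (U′ , refl , eqT) with C₁ , C₂ , refl , σ , τ ← cov eqT
      = S ++ C₁ , C₂ , sym (++-assoc S C₁ _) , ++⁺ ⊆-refl σ , τ

reverse-split : ∀ (U : List A) a V → reverse (U ++ a ∷ V) ≡ reverse V ++ a ∷ reverse U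
reverse-split U a V = trans (reverse-++ U (a ∷ V))
    (trans (cong (_++ reverse U) (unfold-reverse a V)) (++-assoc (reverse V) [ a ] (reverse U)))

primitive-reverse : SPrimitive (reverse S) → SPrimitive S
primitive-reverse {S = S} prim (C , scov , C<S) = ¬primitive cov′
  (subst₂ _<_ (sym (length-reverse C)) (sym (length-reverse S)) C<S) prim
  where
  cov′ : Cover (reverse C) (reverse S)
  cov′ {U} {a} {V} eq
    with C₁ , C₂ , refl , σ , τ ← SCover⇒Cover scov
      (trans (sym (reverse-involutive S)) (trans (cong reverse eq) (reverse-split U a V)))
    = reverse C₂ , reverse C₁ , reverse-split C₁ a C₂ ,
      subst (_ ⊆_) (reverse-involutive U) (reverse⁺ τ) , subst (_ ⊆_) (reverse-involutive V) (reverse⁺ σ)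

-- Each of the two copies of `w` is itself an occurrence of `w`, so `w` covers `w ++ w`, a factor of
-- the whole word.
primitive⇒square-free : ∀ x (W T : List A) → ¬ SPrimitive ((x ∷ W) ++ (x ∷ W) ++ T)
primitive⇒square-free x W T prim =
  ¬primitive cov (subst (length w <_) (sym (length-++ w)) (m<m+n (length w) (s≤s z≤n)))
    (primitive-++ˡ (w ++ w) T (subst SPrimitive (sym (++-assoc w w T)) prim))
  where
  w = x ∷ W
  cov : Cover w (w ++ w)
  cov eq with ++-split w eq
  ... | inj₁ (V′ , eq′ , refl) = _ , V′ , eq′ , ⊆-refl , ++⁺ʳ w ⊆-refl
  ... | inj₂ (U′ , refl , eq′) = U′ , _ , eq′ , ++⁺ˡ w ⊆-refl , ⊆-refl

map-split : (f : A → B) (S : List A) {U V : List B} {b : B} → map f S ≡ U ++ b ∷ V →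
  ∃₂ λ U′ V′ → ∃ λ a → S ≡ U′ ++ a ∷ V′ × map f U′ ≡ U × f a ≡ b × map f V′ ≡ V
map-split f (s ∷ S) {[]} refl = [] , S , s , refl , refl , refl , refl
map-split f (s ∷ S) {u ∷ U} eq with refl , eq′ ← ∷-injective eq
  with U′ , V′ , a , refl , refl , e , e′ ← map-split f S eq′ = s ∷ U′ , V′ , a , refl , refl , e , e′

-- Applying `f` to a cover gives a cover of the image and keeps lengths. With `f = punchIn c`, an
-- s-primitive word avoiding `c` counts as one over an alphabet with one letter fewer.
primitive-map : (f : A → B) → SPrimitive (map f S) → SPrimitive S
primitive-map {S = S} f prim (C , scov , C<S) = ¬primitive cov′
  (subst₂ _<_ (sym (length-map f C)) (sym (length-map f S)) C<S) prim
  where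
  cov′ : Cover (map f C) (map f S)
  cov′ eq with U′ , V′ , a , eqS , refl , refl , refl ← map-split f S eq
    with C₁ , C₂ , refl , σ , τ ← SCover⇒Cover scov eqS
    = map f C₁ , map f C₂ , map-++ f C₁ (a ∷ C₂) , map⁺ f σ , map⁺ f τ

avoid⇒map-punchIn : ∀ {n} (c : Fin (suc n)) (F : List (Fin (suc n))) → c ∉ F → ∃ λ F′ → F ≡ map (punchIn c) F′
avoid⇒map-punchIn c [] c∉F = [] , refl
avoid⇒map-punchIn c (x ∷ F) c∉F with F′ , refl ← avoid⇒map-punchIn c F (c∉F ∘ there)
  = punchOut (c∉F ∘ here) ∷ F′ , cong (_∷ _) (sym (F.punchIn-punchOut (c∉F ∘ here)))

primitive-tail : SPrimitive (a ∷ S) → SPrimitive S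
primitive-tail {a = a} {S = S} = primitive-++ʳ [ a ] S

primitive⇒≢ : SPrimitive (a ∷ b ∷ S) → a ≢ b
primitive⇒≢ {S = S} prim refl = primitive⇒square-free _ [] S prim

primitive-aba⇒≢ : SPrimitive (a ∷ b ∷ a ∷ d ∷ S) → d ≢ b
primitive-aba⇒≢ {a = a} {b = b} {S = S} prim refl = primitive⇒square-free a [ b ] S prim

-- Discarding end letters

-- The second word is the one read backwards from the end: a longer word with first letters p q and last
-- letters q′ p′ is good when no letter is at once among the first two and the last two, except possibly as both q and q′.
data Cut {A : Set} : ℕ → List A → List A → Set where
  good  : p ≢ p′ → p ≢ q′ → q ≢ p′ → Cut i (p ∷ q ∷ s) (p′ ∷ q′ ∷ t)
  left  : Cut i s t → Cut (suc i) (p ∷ s) t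
  right : Cut i s t → Cut (suc i) s (p ∷ t)

Cut-sym : Cut i s t → Cut i t s
Cut-sym (good p≢p′ p≢q′ q≢p′) = good (p≢p′ ∘ sym) (q≢p′ ∘ sym) (p≢q′ ∘ sym)
Cut-sym (left cut) = right (Cut-sym cut)
Cut-sym (right cut) = left (Cut-sym cut)

module _ (_≟_ : DecidableEquality A) where

  -- Discarding the common `a` on one side suffices unless both third letters are again `a`. Then
  -- both first letters go, and the remaining coincidence is the case `q = q′` that `good` permits.
  cut-same-first : b ≢ c → SPrimitive (a ∷ b ∷ d ∷ s) → SPrimitive (a ∷ c ∷ e ∷ t) →
    Cut {A} (suc (suc i)) (a ∷ b ∷ d ∷ s) (a ∷ c ∷ e ∷ t)
  cut-same-first {b = b} {c = c} {a = a} {d = d} {e = e} b≢c ps pt with d ≟ a | e ≟ a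
  ... | no d≢a | _ = left (good (primitive⇒≢ ps ∘ sym) b≢c d≢a)
  ... | _ | no e≢a = right (good (primitive⇒≢ pt) (e≢a ∘ sym) b≢c)
  ... | yes refl | yes refl = left (right (good b≢c (primitive⇒≢ ps ∘ sym) (primitive⇒≢ pt)))

  -- Each comparison that fails yields a cut. If all succeed, the left word begins `abcab`, and only
  -- `f = c` could spoil the last cut; it would complete the square of `abc`.
  cut-crossed : b ≢ c →
    SPrimitive (a ∷ b ∷ d ∷ d′ ∷ e ∷ f ∷ s) → SPrimitive (c ∷ a ∷ b′ ∷ c′ ∷ e′ ∷ t) →
    Cut {A} 6 (a ∷ b ∷ d ∷ d′ ∷ e ∷ f ∷ s) (c ∷ a ∷ b′ ∷ c′ ∷ e′ ∷ t)
  cut-crossed {b = b} {c = c} {a = a} {d = d} {d′ = d′} {e = e} {f = f} {b′ = b′} {c′ = c′} b≢c ps pt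
    with b ≟ b′
  ... | no b≢b′ = right (cut-same-first b≢b′ ps (primitive-tail pt))
  ... | yes refl with d ≟ c
  ...   | no d≢c = left (good b≢c (primitive⇒≢ ps ∘ sym) d≢c)
  ...   | yes refl with c′ ≟ c
  ...     | no c′≢c = left (right (right
              (cut-same-first (c′≢c ∘ sym) (primitive-tail ps) (primitive-tail (primitive-tail pt)))))
  ...     | yes refl with d′ ≟ a
  ...       | no d′≢a = left (left (right (good (primitive⇒≢ pt) (b≢c ∘ sym) d′≢a)))
  ...       | yes refl with e ≟ b
  ...         | no e≢b = left (left (left (right (right
                  (good (primitive⇒≢ ps) (primitive⇒≢ pt ∘ sym) e≢b)))))
  ...         | yes refl = left (left (left (left (good b≢c (primitive⇒≢ ps ∘ sym)
                  λ { refl → primitive⇒square-free a (b ∷ c ∷ []) _ ps }))))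

  cut-same-start :
    SPrimitive (a ∷ b ∷ c ∷ d ∷ e ∷ f ∷ s) → SPrimitive (a ∷ b ∷ c′ ∷ d′ ∷ e′ ∷ t) →
    Cut {A} 6 (a ∷ b ∷ c ∷ d ∷ e ∷ f ∷ s) (a ∷ b ∷ c′ ∷ d′ ∷ e′ ∷ t)
  cut-same-start {a = a} {b = b} {c = c} {d = d} {e = e} {f = f} {c′ = c′} {d′ = d′} ps pt
    with c ≟ c′
  ... | no c≢c′ = left (right (cut-same-first c≢c′ (primitive-tail ps) (primitive-tail pt)))
  ... | yes refl with c ≟ a
  ...   | yes refl with e ≟ a
  ...     | no e≢a = left (left (left (good (primitive⇒≢ (primitive-tail (primitive-tail ps)) ∘ sym) (primitive-aba⇒≢ ps) e≢a)))
  ...     | yes refl = left (left (left (right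
              (good (primitive-aba⇒≢ ps) (primitive⇒≢ (primitive-tail (primitive-tail ps)) ∘ sym) (primitive⇒≢ ps)))))
  cut-same-start {a = a} {b = b} {c = c} {d = d} {e = e} {f = f} {d′ = d′} ps pt
      | yes refl | no c≢a with d ≟ a | d′ ≟ a
  ... | no d≢a | _ = left (left (good c≢a (primitive⇒≢ (primitive-tail ps) ∘ sym) d≢a))
  ... | _ | no d′≢a = right (right
          (good (c≢a ∘ sym) (d′≢a ∘ sym) (primitive⇒≢ (primitive-tail ps))))
  ... | yes refl | yes refl with e ≟ b
  ...   | no e≢b = left (left (left (right (good (primitive⇒≢ ps) (c≢a ∘ sym) e≢b))))
  -- The one branch that discards six letters, leaving `b f` against `c a`; `f = c` is excluded by
  -- the square of `abc`.
  ...   | yes refl = left (left (left (left (right (right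
            (good (primitive⇒≢ (primitive-tail ps)) (primitive⇒≢ ps ∘ sym)
              λ { refl → primitive⇒square-free a (b ∷ c ∷ []) _ ps }))))))

  cut-swapped :
    SPrimitive (a ∷ b ∷ c ∷ d ∷ e ∷ s) → SPrimitive (b ∷ a ∷ c′ ∷ d′ ∷ e′ ∷ t) →
    Cut {A} 6 (a ∷ b ∷ c ∷ d ∷ e ∷ s) (b ∷ a ∷ c′ ∷ d′ ∷ e′ ∷ t)
  cut-swapped {a = a} {b = b} {c = c} {c′ = c′} ps pt with c ≟ a
  ... | no c≢a = left (cut-same-first c≢a (primitive-tail ps) pt)
  ... | yes refl with b ≟ c′
  ...   | no b≢c′ = right (cut-same-first b≢c′ ps (primitive-tail pt))
  ...   | yes refl = left (left (right (cut-same-first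
            (primitive-aba⇒≢ ps)
            (primitive-tail (primitive-tail ps)) (primitive-tail pt))))

  cut-six : ∀ (s t : List A) → length s ≡ 6 → length t ≡ 6 → SPrimitive s → SPrimitive t → Cut 6 s t
  cut-six (a ∷ b ∷ c ∷ d ∷ e ∷ f ∷ []) (a′ ∷ b′ ∷ c′ ∷ d′ ∷ e′ ∷ f′ ∷ []) refl refl ps pt
    with a ≟ a′ | a ≟ b′ | b ≟ a′
  ... | no a≢a′ | no a≢b′ | no b≢a′ = good a≢a′ a≢b′ b≢a′
  ... | no _ | yes refl | no b≢a′ = cut-crossed b≢a′ ps pt
  ... | no _ | no a≢b′ | yes refl = Cut-sym (cut-crossed (a≢b′ ∘ sym) pt ps)
  ... | no _ | yes refl | yes refl = cut-swapped ps pt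
  ... | yes refl | _ | _ with b ≟ b′
  ...   | no b≢b′ = cut-same-first b≢b′ ps pt
  ...   | yes refl = cut-same-start ps pt

  -- First and last occurrences

  filter-split : ∀ {P : A → Set} (P? : Decidable P) xs {ys zs} → filter P? xs ≡ ys ++ a ∷ zs →
    ∃₂ λ ys′ zs′ → xs ≡ ys′ ++ a ∷ zs′ × ys ⊆ ys′
  filter-split P? [] {[]} ()
  filter-split P? [] {_ ∷ _} ()
  filter-split P? (x ∷ xs) {ys} eq with P? x
  filter-split P? (x ∷ xs) {[]} refl | yes _ = [] , xs , refl , []
  filter-split P? (x ∷ xs) {y ∷ ys} eq | yes _ with refl , eq′ ← ∷-injective eq
    with ys′ , zs′ , refl , τ ← filter-split P? xs eq′ = x ∷ ys′ , zs′ , refl , refl ∷ τ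
  ... | no _ with ys′ , zs′ , refl , τ ← filter-split P? xs eq = x ∷ ys′ , zs′ , refl , x ∷ʳ τ

  firsts lasts : List A → List A
  firsts = deduplicate _≟_
  lasts S = reverse (firsts (reverse S))

  -- The letters of `π₁` make their first appearances, in this order, before the first `a`, hence
  -- before every `a`. This is half of each occurrence of the cover constructed later.
  firsts-order : ∀ S {π₁ π₂} → S ≡ U ++ a ∷ V → firsts S ≡ π₁ ++ a ∷ π₂ → π₁ ⊆ U
  firsts-order {U = U} S {[]} _ _ = minimum U
  firsts-order {U = []} (s ∷ S) {x ∷ π₁} refl eq with refl , eq′ ← ∷-injective eq =
    ⊥-elim (proj₂ (∈-filter⁻ (¬? ∘ (s ≟_)) {xs = firsts S} (subst (s ∈_) (sym eq′) (∈-insert π₁))) refl)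
  firsts-order {U = u ∷ U} (s ∷ S) {x ∷ π₁} refl eq with refl , eq′ ← ∷-injective eq
    with _ , _ , eq″ , τ ← filter-split _ (firsts S) eq′ = refl ∷ ⊆-trans τ (firsts-order S refl eq″)

  lasts-order : ∀ S {σ₁ σ₂} → S ≡ U ++ a ∷ V → lasts S ≡ σ₁ ++ a ∷ σ₂ → σ₂ ⊆ V
  lasts-order {U = U} {a = a} {V = V} S {σ₁} {σ₂} refl eq = reverse⁻ (firsts-order (reverse S)
    (reverse-split U a V)
    (trans (sym (reverse-involutive _)) (trans (cong reverse eq) (reverse-split σ₁ a σ₂))))

  firsts-∷∷ : p ≢ q → ∀ {S R} → S ≡ p ∷ q ∷ R → ∃ λ τ → firsts S ≡ p ∷ q ∷ τ
  firsts-∷∷ p≢q refl = _ , cong (_ ∷_) (filter-accept (¬? ∘ (_ ≟_)) p≢q)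

-- Words without repeated letters

Unique-⊆ : S ⊆ T → Unique T → Unique S
Unique-⊆ [] [] = []
Unique-⊆ (_ ∷ʳ τ) (_ ∷ u) = Unique-⊆ τ u
Unique-⊆ (refl ∷ τ) (x∉ ∷ u) = All-resp-⊆ τ x∉ ∷ Unique-⊆ τ u

Unique-reverse : Unique S → Unique (reverse S)
Unique-reverse [] = []
Unique-reverse {S = x ∷ S} (x∉ ∷ u) = subst Unique (sym (unfold-reverse x S))
  (Unique.++⁺ (Unique-reverse u) ([] ∷ []) λ { (z∈ , here refl) → All.lookup x∉ (Any.reverse⁻ z∈) refl })

Unique⇒lookup-injective : Unique S → ∀ i j → lookup S i ≡ lookup S j → i ≡ j
Unique⇒lookup-injective (x∉ ∷ u) zero zero eq = refl
Unique⇒lookup-injective {S = _ ∷ S} (x∉ ∷ u) zero (suc j) eq = ⊥-elim (All.lookup x∉ (∈-lookup {xs = S} j) eq)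
Unique⇒lookup-injective {S = _ ∷ S} (x∉ ∷ u) (suc i) zero eq = ⊥-elim (All.lookup x∉ (∈-lookup {xs = S} i) (sym eq))
Unique⇒lookup-injective (x∉ ∷ u) (suc i) (suc j) eq = cong suc (Unique⇒lookup-injective u i j eq)

Unique⇒length≤ : ∀ {k} {S : List (Fin k)} → Unique S → length S ≤ k
Unique⇒length≤ u = F.injective⇒≤ (Unique⇒lookup-injective u _ _)

-- The cover π σ

-- ρ is π = π⁻ ∷ʳ y without its last letter when the juxtaposition of π and σ = x ∷ … would repeat it.
data Trimmed {A : Set} (x y : A) (π⁻ : List A) : List A → Set where
  merged : x ≡ y → Trimmed x y π⁻ π⁻
  apart  : x ≢ y → Trimmed x y π⁻ (π⁻ ++ [ y ])

index≥2 : ∀ {u v τ : List A} → u ++ a ∷ v ≡ p ∷ q ∷ τ →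
  (a ≡ p × length u ≡ 0) ⊎ (a ≡ q × length u ≡ 1) ⊎ 2 ≤ length u
index≥2 {u = []} refl = inj₁ (refl , refl)
index≥2 {u = _ ∷ []} refl = inj₂ (inj₁ (refl , refl))
index≥2 {u = _ ∷ _ ∷ _} _ = inj₂ (inj₂ (s≤s (s≤s z≤n)))

⊆-drop-last : x ≢ y → (T : List A) → S ++ [ y ] ⊆ T ++ [ x ] → S ++ [ y ] ⊆ T
⊆-drop-last {x = x} {y = y} {S = S} x≢y T τ = reverse⁻ (subst (_⊆ reverse T) (sym (reverse-++ S [ y ]))
  (∷ʳ⁻ (x≢y ∘ sym) (subst₂ _⊆_ (reverse-++ S [ y ]) (reverse-++ T [ x ]) (reverse⁺ τ))))

Unique-++ʳ : (S : List A) → Unique (S ++ T) → Unique T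
Unique-++ʳ S = Unique-⊆ (++⁺ˡ S ⊆-refl)

Unique-++ˡ : Unique (S ++ T) → Unique S
Unique-++ˡ {T = T} = Unique-⊆ (++⁺ʳ T ⊆-refl)

Unique-∷ʳ : (S : List A) → Unique (S ++ [ y ]) → y ∉ S
Unique-∷ʳ (s ∷ S) (s∉ ∷ _) (here refl) = All.lookup s∉ (∈-insert S) refl
Unique-∷ʳ (s ∷ S) (_ ∷ u) (there y∈) = Unique-∷ʳ S u y∈

module _ {m n : ℕ} (3≤m : 3 ≤ m) (2≤n : 2 ≤ n)
  (short : ∀ {F : List (Fin (suc m))} {c} → SPrimitive F → c ∉ F → length F ≤ n) where

  private
    Word = List (Fin (suc m))
    variable
      w π⁻ ρ ρ₂ σ₁ σ₂ σ⁺ : Word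

  open DecMembership (F._≟_ {suc m}) using (_∈?_)
  open DecSublist (F._≟_ {suc m}) using (_⊆?_)

  first-split : ∀ {W : Word} → a ∈ W → ∃₂ λ U V → W ≡ U ++ a ∷ V × a ∉ U
  first-split {a = a} {W = b ∷ W} a∈ with a F.≟ b | a∈
  ... | yes refl | _ = [] , W , refl , λ ()
  ... | no a≢b | here a≡b = ⊥-elim (a≢b a≡b)
  ... | no a≢b | there a∈W with U , V , refl , a∉U ← first-split a∈W
      = b ∷ U , V , refl , λ { (here a≡b) → a≢b a≡b ; (there a∈U) → a∉U a∈U }

  last-split : ∀ {W : Word} → a ∈ W → ∃₂ λ U V → W ≡ U ++ a ∷ V × a ∉ V
  last-split {a = a} {W = b ∷ W} a∈ with a ∈? W | a∈
  ... | no a∉W | here refl = [] , W , refl , a∉W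
  ... | no a∉W | there a∈W = ⊥-elim (a∉W a∈W)
  ... | yes a∈W | _ with U , V , refl , a∉V ← last-split a∈W = b ∷ U , V , refl , a∉V

  -- A letter of w found in W opens the next piece: being distinct from the letter sought there, it costs nothing extra.
  ⊈⇒length≤ : ∀ w → Unique w → ∀ {W} → SPrimitive W → ¬ w ⊆ W → length W ≤ length w * n
  ⊈⇒length≤ [] _ _ w⊈W = ⊥-elim (w⊈W (minimum _))
  ⊈⇒length≤ (x ∷ w) (x∉w ∷ u) {W} prim w⊈W with x ∈? W
  ... | no x∉W = ≤-trans (short prim x∉W) (m≤m+n n _)
  ... | yes x∈W with U , V , refl , x∉U ← first-split x∈W = begin
      length (U ++ x ∷ V)           ≡⟨ length-++ U ⟩
      length U + length (x ∷ V)     ≤⟨ +-mono-≤ (short (primitive-++ˡ U _ prim) x∉U)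
                                        (⊈⇒length≤ w u (primitive-++ʳ U _ prim) (w⊈xV w x∉w w⊈V)) ⟩
      n + length w * n              ∎
    where
    open ≤-Reasoning
    w⊈V : ¬ w ⊆ V
    w⊈V τ = w⊈W (++⁺ˡ U (refl ∷ τ))
    w⊈xV : ∀ w → All (x ≢_) w → ¬ w ⊆ V → ¬ w ⊆ x ∷ V
    w⊈xV [] _ w⊈V _ = w⊈V (minimum V)
    w⊈xV (y ∷ w) (x≢y ∷ _) w⊈V τ = w⊈V (∷ʳ⁻ (x≢y ∘ sym) τ)

  -- The last `x` cuts `V`. What follows it misses `x`. What precedes it omits `ρ₂`, because
  -- `x ∷ σ⁺` fits from there on, and still omits `ρ₂` with `a` added in front and `x` behind: `ρ₂`
  -- neither begins with `a` nor needs a final `x`.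
  after-length≤ : Unique (a ∷ ρ₂) → (∀ T → ρ₂ ⊆ T ++ [ x ] → ρ₂ ⊆ T) →
    (∀ {V₁ V₂} → V ≡ V₁ ++ x ∷ V₂ → σ⁺ ⊆ V₂) → SPrimitive (a ∷ V) → ¬ (ρ₂ ++ x ∷ σ⁺ ⊆ V) →
    length (a ∷ V) ≤ suc (length ρ₂ ⊔ 1) * n
  after-length≤ {a = a} {ρ₂ = ρ₂} {x = x} {V = V} (a∉ρ₂ ∷ u) ends σ⁺⊆ prim ⊈V with x ∈? V
  -- Here `V` costs one `n` and the letter `a` is charged a second one, which is the source of
  -- `⊔ 1`.
  ... | no x∉V = begin
      1 + length V                  ≤⟨ +-mono-≤ (≤-trans (s≤s z≤n) 2≤n) (short (primitive-tail prim) x∉V) ⟩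
      n + n                         ≡⟨ cong (n +_) (sym (+-identityʳ n)) ⟩
      2 * n                         ≤⟨ *-monoˡ-≤ n (s≤s (m≤n⊔m (length ρ₂) 1)) ⟩
      suc (length ρ₂ ⊔ 1) * n       ∎
    where open ≤-Reasoning
  ... | yes x∈V with V₁ , V₂ , refl , x∉V₂ ← last-split x∈V = begin
      length (a ∷ V₁ ++ x ∷ V₂)             ≡⟨ cong length (sym split) ⟩
      length ((a ∷ V₁ ++ [ x ]) ++ V₂)      ≡⟨ length-++ (a ∷ V₁ ++ [ x ]) ⟩
      length (a ∷ V₁ ++ [ x ]) + length V₂  ≤⟨ +-mono-≤
          (⊈⇒length≤ ρ₂ u (primitive-++ˡ _ V₂ prim′) (ρ₂⊈ ρ₂ a∉ρ₂ ends ρ₂⊈V₁))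
          (short (primitive-++ʳ (a ∷ V₁ ++ [ x ]) V₂ prim′) x∉V₂) ⟩
      length ρ₂ * n + n                     ≡⟨ +-comm (length ρ₂ * n) n ⟩
      suc (length ρ₂) * n                   ≤⟨ *-monoˡ-≤ n (s≤s (m≤m⊔n (length ρ₂) 1)) ⟩
      suc (length ρ₂ ⊔ 1) * n               ∎
    where
    open ≤-Reasoning
    split : (a ∷ V₁ ++ [ x ]) ++ V₂ ≡ a ∷ V₁ ++ x ∷ V₂
    split = ++-assoc (a ∷ V₁) [ x ] V₂
    prim′ = subst SPrimitive (sym split) prim
    ρ₂⊈V₁ : ¬ ρ₂ ⊆ V₁
    ρ₂⊈V₁ τ = ⊈V (++⁺ τ (refl ∷ σ⁺⊆ refl))
    ρ₂⊈ : ∀ w → All (a ≢_) w → (∀ T → w ⊆ T ++ [ x ] → w ⊆ T) → ¬ w ⊆ V₁ → ¬ w ⊆ a ∷ V₁ ++ [ x ]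
    ρ₂⊈ [] _ _ w⊈ _ = w⊈ (minimum V₁)
    ρ₂⊈ (y ∷ w) (a≢y ∷ _) ends w⊈ τ = w⊈ (ends V₁ (∷ʳ⁻ (a≢y ∘ sym) τ))

  -- When merged, `y` is still available to `σ₁`. When apart, `y` ends `ρ`, but a non-empty `σ₁`
  -- begins with `x ≢ y` and so already fits in `W₂`.
  trimmed-++-⊆ : ∀ {W₁ W₂} → Trimmed x y π⁻ ρ → π⁻ ⊆ W₁ → σ₁ ++ a ∷ σ₂ ≡ x ∷ σ⁺ → σ₁ ⊆ y ∷ W₂ →
    ρ ++ σ₁ ⊆ W₁ ++ y ∷ W₂
  trimmed-++-⊆ (merged _) τ _ υ = ++⁺ τ υ
  trimmed-++-⊆ {y = y} {π⁻ = π⁻} {σ₁ = []} (apart _) τ _ _ =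
    subst (_⊆ _) (sym (++-identityʳ (π⁻ ++ [ y ]))) (++⁺ τ (refl ∷ minimum _))
  trimmed-++-⊆ {y = y} {π⁻ = π⁻} {σ₁ = _ ∷ _} (apart x≢y) τ refl υ =
    subst (_⊆ _) (sym (++-assoc π⁻ [ y ] _)) (++⁺ τ (refl ∷ ∷ʳ⁻ x≢y υ))

  -- Counterpart of `after-length≤`, cut at the first `y`: the part before it misses `y`, and the
  -- part from `y` on omits `σ₁`, since `π⁻` already fits in front.
  before-length≤ : Trimmed x y π⁻ ρ → (∀ {W₁ W₂} → W ≡ W₁ ++ y ∷ W₂ → π⁻ ⊆ W₁) →
    Unique (x ∷ σ⁺) → σ₁ ++ a ∷ σ₂ ≡ x ∷ σ⁺ → SPrimitive W → ¬ (ρ ++ σ₁ ⊆ W) →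
    length W ≤ suc (length σ₁) * n
  before-length≤ {y = y} {W = W} {σ₁ = σ₁} trim π⁻⊆ u eq prim ⊈W with y ∈? W
  ... | no y∉W = ≤-trans (short prim y∉W) (m≤m+n n _)
  ... | yes y∈W with W₁ , W₂ , refl , y∉W₁ ← first-split y∈W = begin
      length (W₁ ++ y ∷ W₂)           ≡⟨ length-++ W₁ ⟩
      length W₁ + length (y ∷ W₂)     ≤⟨ +-mono-≤ (short (primitive-++ˡ W₁ _ prim) y∉W₁)
          (⊈⇒length≤ σ₁ (Unique-++ˡ (subst Unique (sym eq) u)) (primitive-++ʳ W₁ _ prim)
            λ τ → ⊈W (trimmed-++-⊆ trim (π⁻⊆ refl) eq τ)) ⟩
      n + length σ₁ * n               ∎
    where open ≤-Reasoning

  trimmed-prefix : Trimmed x y π⁻ ρ → ∃ λ ρ′ → ρ ++ ρ′ ≡ π⁻ ++ [ y ]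
  trimmed-prefix {y = y} (merged _) = [ y ] , refl
  trimmed-prefix (apart _) = [] , ++-identityʳ _

  -- This is why `Trimmed` is used: `ρ` never ends with `x`, so the cut letter `x` appended to a
  -- piece cannot help to complete a suffix of `ρ`.
  trimmed-last : ∀ {z} → Unique (π⁻ ++ [ y ]) → Trimmed x y π⁻ ρ → ρ ≡ w ++ [ z ] → x ≢ z
  trimmed-last {w = w} u (merged refl) refl refl = Unique-∷ʳ _ u (∈-insert w)
  trimmed-last {π⁻ = π⁻} {w = w} u (apart x≢y) eq refl = x≢y (sym (∷ʳ-injectiveʳ π⁻ w eq))

  trimmed-∈ : Trimmed x y π⁻ ρ → a ∈ π⁻ ++ [ y ] → a ∈ ρ ⊎ (a ≡ x × a ≡ y × ρ ≡ π⁻)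
  trimmed-∈ (apart _) a∈ = inj₁ a∈
  trimmed-∈ {π⁻ = π⁻} (merged x≡y) a∈ with ∈-++⁻ π⁻ a∈
  ... | inj₁ a∈π⁻ = inj₁ a∈π⁻
  ... | inj₂ (here a≡y) = inj₂ (trans a≡y (sym x≡y) , a≡y , refl)

  trim : ∀ x y π⁻ → ∃ (Trimmed {Fin (suc m)} x y π⁻)
  trim x y π⁻ with x F.≟ y
  ... | yes x≡y = π⁻ , merged x≡y
  ... | no x≢y = π⁻ ++ [ y ] , apart x≢y

  -- The maximum absorbs the letter at the bad position itself; for r₂ = 0 this is paid for by 3 ≤ m.
  index-sum : ∀ r₁ r₂ s₁ s₂ → r₁ + r₂ ≤ m → s₁ + s₂ ≤ m → 2 ≤ r₁ + s₂ →
    suc s₁ + suc (r₂ ⊔ 1) ≤ m + m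
  index-sum r₁ zero s₁ s₂ r≤ s≤ 2≤ = begin
    suc s₁ + 2   ≡⟨ sym (+-suc s₁ 2) ⟩
    s₁ + 3       ≤⟨ +-mono-≤ (≤-trans (m≤m+n s₁ s₂) s≤) 3≤m ⟩
    m + m        ∎
    where open ≤-Reasoning
  index-sum r₁ r₂@(suc r) s₁ s₂ r≤ s≤ 2≤ = begin
    suc s₁ + suc (r₂ ⊔ 1)        ≡⟨ cong (λ i → suc s₁ + suc i) (m≥n⇒m⊔n≡m {r₂} (s≤s z≤n)) ⟩
    suc s₁ + suc r₂              ≡⟨ +-suc (suc s₁) r₂ ⟩
    2 + (s₁ + r₂)                ≤⟨ +-monoˡ-≤ (s₁ + r₂) 2≤ ⟩
    (r₁ + s₂) + (s₁ + r₂)        ≡⟨ cong (r₁ + s₂ +_) (+-comm s₁ r₂) ⟩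
    (r₁ + s₂) + (r₂ + s₁)        ≡⟨ +-assoc r₁ s₂ (r₂ + s₁) ⟩
    r₁ + (s₂ + (r₂ + s₁))        ≡⟨ cong (r₁ +_) (trans (+-comm s₂ (r₂ + s₁)) (+-assoc r₂ s₁ s₂)) ⟩
    r₁ + (r₂ + (s₁ + s₂))        ≡⟨ sym (+-assoc r₁ r₂ _) ⟩
    (r₁ + r₂) + (s₁ + s₂)        ≤⟨ +-mono-≤ r≤ s≤ ⟩
    m + m                        ∎
    where open ≤-Reasoning

  -- A letter of `ρ` appears again in `x ∷ σ⁺`, which offers two ways to pass through its position.
  -- If both fail, the bounds before and after the position, added up by `index`, contradict the
  -- assumed length.
  trimmed-cover : ∀ {S : Word} → SPrimitive S → (m + m) * n < length S →
    firsts F._≟_ S ≡ π⁻ ++ [ y ] → lasts F._≟_ S ≡ x ∷ σ⁺ → Trimmed x y π⁻ ρ →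
    (∀ {ρ₁ ρ₂ σ₁ σ₂} a → ρ₁ ++ a ∷ ρ₂ ≡ ρ → σ₁ ++ a ∷ σ₂ ≡ x ∷ σ⁺ →
      suc (length σ₁) + suc (length ρ₂ ⊔ 1) ≤ m + m) →
    Cover (ρ ++ x ∷ σ⁺) S
  trimmed-cover {π⁻ = π⁻} {y = y} {x = x} {σ⁺ = σ⁺} {ρ = ρ} {S = S} prim long eqπ eqσ trim index {U} {a} {V} eqS =
    through-a (trimmed-∈ trim (subst (a ∈_) eqπ (∈-deduplicate⁺ F._≟_ a∈S)))
      (∈-∃++ (subst (a ∈_) eqσ (Any.reverse⁺ (∈-deduplicate⁺ F._≟_ (Any.reverse⁺ a∈S)))))
    where
    a∈S : a ∈ S
    a∈S = subst (a ∈_) (sym eqS) (∈-insert U)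
    primUaV : SPrimitive (U ++ a ∷ V)
    primUaV = subst SPrimitive eqS prim
    uniqueπ : Unique (π⁻ ++ [ y ])
    uniqueπ = subst Unique eqπ (DecUnique.deduplicate-! F._≟_ S)
    uniqueσ : Unique (x ∷ σ⁺)
    uniqueσ = subst Unique eqσ (Unique-reverse (DecUnique.deduplicate-! F._≟_ (reverse S)))
    ρ′ = proj₁ (trimmed-prefix trim)
    prefix : ∀ {ρ₁ ρ₂} → ρ ≡ ρ₁ ++ a ∷ ρ₂ → firsts F._≟_ S ≡ ρ₁ ++ a ∷ (ρ₂ ++ ρ′)
    prefix {ρ₁} refl = trans eqπ (trans (sym (proj₂ (trimmed-prefix trim))) (++-assoc ρ₁ _ ρ′))
    ends : ∀ ρ₁ ρ₂ → ρ ≡ ρ₁ ++ a ∷ ρ₂ → ∀ T → ρ₂ ⊆ T ++ [ x ] → ρ₂ ⊆ T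
    ends ρ₁ ρ₂ eq T τ with initLast ρ₂
    ... | [] = minimum T
    ... | ρ₂⁻ ∷ʳ′ z = ⊆-drop-last
            (trimmed-last {w = ρ₁ ++ a ∷ ρ₂⁻} uniqueπ trim (trans eq (sym (++-assoc ρ₁ _ [ z ])))) T τ

    through-a : a ∈ ρ ⊎ (a ≡ x × a ≡ y × ρ ≡ π⁻) →
      (∃₂ λ σ₁ σ₂ → x ∷ σ⁺ ≡ σ₁ ++ a ∷ σ₂) → Through (ρ ++ x ∷ σ⁺) U a V
    -- The merged letter is the only one absent from `ρ`. At each of its positions `π⁻` fits before
    -- and `σ⁺` after, so no length argument is needed.
    through-a (inj₂ (refl , refl , refl)) _ =
      ρ , σ⁺ , refl , firsts-order F._≟_ S eqS eqπ , lasts-order F._≟_ S {σ₁ = []} eqS eqσ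
    through-a (inj₁ a∈ρ) (σ₁ , σ₂ , eq₂) with ρ₁ , ρ₂ , eq₁ ← ∈-∃++ a∈ρ
      with ρ₂ ++ x ∷ σ⁺ ⊆? V | ρ ++ σ₁ ⊆? U
    ... | yes τ | _ = ρ₁ , ρ₂ ++ x ∷ σ⁺ ,
            trans (cong (_++ x ∷ σ⁺) eq₁) (++-assoc ρ₁ _ _) , firsts-order F._≟_ S eqS (prefix eq₁) , τ
    ... | _ | yes τ = ρ ++ σ₁ , σ₂ ,
            trans (cong (ρ ++_) eq₂) (sym (++-assoc ρ σ₁ _)) , τ ,
            lasts-order F._≟_ S {σ₁ = σ₁} eqS (trans eqσ eq₂)
    ... | no ⊈V | no ⊈U = ⊥-elim (<⇒≱ long (begin
        length S                        ≡⟨ trans (cong length eqS) (length-++ U) ⟩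
        length U + length (a ∷ V)       ≤⟨ +-mono-≤
            (before-length≤ trim (λ { {W₁} refl → firsts-order F._≟_ S (trans eqS (++-assoc W₁ _ _)) eqπ })
              uniqueσ (sym eq₂) (primitive-++ˡ U _ primUaV) ⊈U)
            (after-length≤
              (Unique-++ˡ (Unique-++ʳ ρ₁ (subst Unique (trans (sym eqπ) (prefix eq₁)) uniqueπ)))
              (ends ρ₁ ρ₂ eq₁)
              (λ { {V₁} refl → lasts-order F._≟_ S {σ₁ = []} (trans eqS (sym (++-assoc U (a ∷ V₁) _))) eqσ })
              (primitive-++ʳ U _ primUaV) ⊈V) ⟩
        suc (length σ₁) * n + suc (length ρ₂ ⊔ 1) * n
                                        ≡⟨ sym (*-distribʳ-+ n (suc (length σ₁)) _) ⟩
        (suc (length σ₁) + suc (length ρ₂ ⊔ 1)) * n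
                                        ≤⟨ *-monoˡ-≤ n (index a (sym eq₁) (sym eq₂)) ⟩
        (m + m) * n                     ∎))
      where open ≤-Reasoning

  -- Words with good ends

  split-length≤ : ∀ {S S₁ S₂ : Word} → Unique S → S ≡ S₁ ++ a ∷ S₂ → length S₁ + length S₂ ≤ m
  split-length≤ {S₁ = S₁} {S₂} u refl = ≤-pred (begin
    suc (length S₁ + length S₂)   ≡⟨ sym (+-suc (length S₁) _) ⟩
    length S₁ + suc (length S₂)   ≡⟨ sym (length-++ S₁) ⟩
    length (S₁ ++ _ ∷ S₂)         ≤⟨ Unique⇒length≤ u ⟩
    suc m                         ∎)
    where open ≤-Reasoning

  good-length≤ : ∀ {S R R′ : Word} → SPrimitive S → S ≡ p ∷ q ∷ R → reverse S ≡ p′ ∷ q′ ∷ R′ →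
    p ≢ p′ → p ≢ q′ → q ≢ p′ → length S ≤ (m + m) * n
  good-length≤ {p = p} {q = q} {p′ = p′} {q′ = q′} {S = S} {R} {R′} prim eqS eqS′ p≢p′ p≢q′ q≢p′ =
    ≮⇒≥ λ long → by-cover long (initLast (firsts F._≟_ S)) refl (lasts F._≟_ S) refl
    where
    open ≤-Reasoning
    prim′ : SPrimitive (reverse S)
    prim′ = primitive-reverse (subst SPrimitive (sym (reverse-involutive S)) prim)
    firsts-S = firsts-∷∷ F._≟_ (primitive⇒≢ (subst SPrimitive eqS prim)) eqS
    firsts-S′ = firsts-∷∷ F._≟_ (primitive⇒≢ (subst SPrimitive eqS′ prim′)) eqS′
    uniqueπ = DecUnique.deduplicate-! F._≟_ S
    uniqueσ = Unique-reverse (DecUnique.deduplicate-! F._≟_ (reverse S))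

    -- The index pairs with sum below two are (0,0), (0,1) and (1,0), which the three inequalities
    -- exclude. The coincidence `q = q′` gives (1,1), whose sum is already two; hence `good` allows
    -- it.
    ends≥2 : ∀ {π₁ π₂ σ₁ σ₂} a → firsts F._≟_ S ≡ π₁ ++ a ∷ π₂ → lasts F._≟_ S ≡ σ₁ ++ a ∷ σ₂ →
      2 ≤ length π₁ + length σ₂
    ends≥2 {π₁} {π₂} {σ₁} {σ₂} a eq₁ eq₂
      with index≥2 {u = π₁} (trans (sym eq₁) (proj₂ firsts-S))
         | index≥2 {u = reverse σ₂} (trans (sym (reverse-split σ₁ a σ₂))
             (trans (cong reverse (sym eq₂)) (trans (reverse-involutive _) (proj₂ firsts-S′))))
    ... | inj₂ (inj₂ 2≤) | _ = ≤-trans 2≤ (m≤m+n _ _)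
    ... | _ | inj₂ (inj₂ 2≤) = ≤-trans (subst (2 ≤_) (length-reverse σ₂) 2≤) (m≤n+m _ _)
    ... | inj₁ (refl , _) | inj₁ (e , _) = ⊥-elim (p≢p′ e)
    ... | inj₁ (refl , _) | inj₂ (inj₁ (e , _)) = ⊥-elim (p≢q′ e)
    ... | inj₂ (inj₁ (refl , _)) | inj₁ (e , _) = ⊥-elim (q≢p′ e)
    ... | inj₂ (inj₁ (_ , l₁)) | inj₂ (inj₁ (_ , l₂)) =
          ≤-reflexive (sym (cong₂ _+_ l₁ (trans (sym (length-reverse σ₂)) l₂)))

    by-cover : (m + m) * n < length S →
      ∀ {π} → InitLast π → firsts F._≟_ S ≡ π → ∀ σ → lasts F._≟_ S ≡ σ → ⊥
    by-cover _ [] eqπ _ _ with () ← trans (sym eqπ) (proj₂ firsts-S)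
    by-cover _ _ _ [] eqσ
      with () ← trans (sym (cong reverse eqσ)) (trans (reverse-involutive _) (proj₂ firsts-S′))
    by-cover long (π⁻ ∷ʳ′ y) eqπ (x ∷ σ⁺) eqσ with ρ , trim ← trim x y π⁻ =
      ¬primitive (trimmed-cover prim long eqπ eqσ trim index) short-C prim
      where
      ρ′ = proj₁ (trimmed-prefix trim)
      ρρ′≡π : ρ ++ ρ′ ≡ firsts F._≟_ S
      ρρ′≡π = trans (proj₂ (trimmed-prefix trim)) (sym eqπ)
      index : ∀ {ρ₁ ρ₂ σ₁ σ₂} a → ρ₁ ++ a ∷ ρ₂ ≡ ρ → σ₁ ++ a ∷ σ₂ ≡ x ∷ σ⁺ →
        suc (length σ₁) + suc (length ρ₂ ⊔ 1) ≤ m + m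
      index {ρ₁} {ρ₂} {σ₁} {σ₂} a eq₁ eq₂ = index-sum (length ρ₁) (length ρ₂) (length σ₁) (length σ₂)
        (split-length≤ (Unique-++ˡ {S = ρ} (subst Unique (sym ρρ′≡π) uniqueπ)) (sym eq₁))
        (split-length≤ uniqueσ eqσ₁)
        (ends≥2 a (trans (sym ρρ′≡π) (trans (cong (_++ ρ′) (sym eq₁)) (++-assoc ρ₁ _ ρ′))) eqσ₁)
        where eqσ₁ = trans eqσ (sym eq₂)
      -- The cover has at most `2 * suc m` letters, which is at most `2 * (m + m)` and so at most
      -- `(m + m) * n`; the assumption `long` makes it non-trivial.
      short-C : length (ρ ++ x ∷ σ⁺) < length S
      short-C = begin-strict
        length (ρ ++ x ∷ σ⁺)           ≡⟨ length-++ ρ ⟩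
        length ρ + length (x ∷ σ⁺)     ≤⟨ +-mono-≤
            (Unique⇒length≤ (Unique-++ˡ {S = ρ} (subst Unique (sym ρρ′≡π) uniqueπ)))
            (Unique⇒length≤ (subst Unique eqσ uniqueσ)) ⟩
        suc m + suc m                  ≤⟨ +-mono-≤ 1+m≤m+m 1+m≤m+m ⟩
        (m + m) + (m + m)              ≡⟨ cong (m + m +_) (sym (+-identityʳ (m + m))) ⟩
        2 * (m + m)                    ≤⟨ *-monoˡ-≤ (m + m) 2≤n ⟩
        n * (m + m)                    ≡⟨ *-comm n (m + m) ⟩
        (m + m) * n                    <⟨ long ⟩
        length S                       ∎
        where
        1+m≤m+m : suc m ≤ m + m
        1+m≤m+m = +-monoˡ-≤ m (≤-trans (s≤s z≤n) 3≤m)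

  -- From good ends to all s-primitive words

  cut-length≤ : ∀ {s t : Word} M → Cut i s t → SPrimitive (s ++ M ++ reverse t) →
    length (s ++ M ++ reverse t) ≤ (m + m) * n + i
  cut-length≤ {i = i} M (good {p = p} {p′ = p′} {q′ = q′} {q = q} {s = s} {t = t} p≢p′ p≢q′ q≢p′) prim =
    ≤-trans (good-length≤ prim refl
      (trans (reverse-++ (p ∷ q ∷ s) _) (cong (_++ reverse (p ∷ q ∷ s)) (trans (reverse-++ M _)
        (cong (_++ reverse M) (reverse-involutive (p′ ∷ q′ ∷ t)))))) p≢p′ p≢q′ q≢p′) (m≤m+n _ i)
  -- One discarded letter spends one unit of `i`, and the remaining factor is still s-primitive.
  cut-length≤ M (left cut) prim = ≤-trans (s≤s (cut-length≤ M cut (primitive-tail prim)))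
    (≤-reflexive (sym (+-suc _ _)))
  cut-length≤ M (right {s = s} {t = t} {p = p} cut) prim = begin
    length (s ++ M ++ reverse (p ∷ t))          ≡⟨ cong length split ⟩
    length ((s ++ M ++ reverse t) ++ [ p ])     ≡⟨ length-++ (s ++ M ++ reverse t) ⟩
    length (s ++ M ++ reverse t) + 1            ≤⟨ +-monoˡ-≤ 1 (cut-length≤ M cut
                                                    (primitive-++ˡ _ [ p ] (subst SPrimitive split prim))) ⟩
    ((m + m) * n + _) + 1                       ≡⟨ trans (+-assoc ((m + m) * n) _ 1)
                                                    (cong ((m + m) * n +_) (+-comm _ 1)) ⟩
    (m + m) * n + suc _                         ∎
    where
    open ≤-Reasoning
    split : s ++ M ++ reverse (p ∷ t) ≡ (s ++ M ++ reverse t) ++ [ p ]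
    split = trans (cong (λ r → s ++ M ++ r) (unfold-reverse p t))
      (trans (cong (s ++_) (sym (++-assoc M (reverse t) [ p ]))) (sym (++-assoc s _ [ p ])))

  primitive-length≤ : ∀ {S : Word} → SPrimitive S → length S ≤ (m + m) * n + 6
  primitive-length≤ {S} prim with 12 ≤? length S
  -- Below twelve letters the two six-letter ends could overlap; there the bound holds because 12 =
  -- (3 + 3) * 2.
  ... | no S<12 = ≤-trans (<⇒≤ (≰⇒> S<12))
          (≤-trans (*-mono-≤ (+-mono-≤ 3≤m 3≤m) 2≤n) (m≤m+n ((m + m) * n) 6))
  ... | yes 12≤S = subst (λ S → length S ≤ (m + m) * n + 6) (sym split)
          (cut-length≤ M (cut-six F._≟_ s₆ t₆ length-s length-t
            (primitive-++ˡ s₆ _ primS)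
            (primitive-reverse (primitive-++ʳ M _ (primitive-++ʳ s₆ _ primS)))) primS)
    where
    s₆ = take 6 S
    R = reverse (drop 6 S)
    t₆ = take 6 R
    M = reverse (drop 6 R)
    split : S ≡ s₆ ++ M ++ reverse t₆
    split = trans (sym (take++drop≡id 6 S)) (cong (s₆ ++_) (trans (sym (reverse-involutive (drop 6 S)))
      (trans (cong reverse (sym (take++drop≡id 6 R))) (reverse-++ t₆ (drop 6 R)))))
    primS = subst SPrimitive split prim
    length-s : length s₆ ≡ 6
    length-s = trans (length-take 6 S) (m≤n⇒m⊓n≡m (≤-trans (s≤s (s≤s (s≤s (s≤s (s≤s (s≤s z≤n)))))) 12≤S))
    length-t : length t₆ ≡ 6
    length-t = trans (length-take 6 R) (m≤n⇒m⊓n≡m (subst (6 ≤_)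
      (sym (trans (length-reverse (drop 6 S)) (length-drop 6 S))) (∸-monoˡ-≤ 6 12≤S)))

-- A one-letter cover would have to equal both letters. Such a pair gives `2 ≤ n` in the final
-- application.
pair-primitive : a ≢ b → SPrimitive (a ∷ b ∷ [])
pair-primitive a≢b ([] , cov , _) with SCover⇒Cover cov {U = []} refl
... | [] , _ , () , _
... | _ ∷ _ , _ , () , _
pair-primitive {a = a} a≢b (c ∷ [] , cov , _)
  with [] , _ , refl , _ ← SCover⇒Cover cov {U = []} refl
  with SCover⇒Cover cov {U = [ a ]} refl
... | [] , _ , e , _ = a≢b (∷-injectiveˡ e)
... | _ ∷ [] , _ , () , _
pair-primitive a≢b (_ ∷ _ ∷ _ , _ , s≤s (s≤s ()))

2*[1+m]∸2 : ∀ m → 2 * suc m ∸ 2 ≡ m + m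
2*[1+m]∸2 m = trans (cong (_∸ 1) (+-suc m (m + 0))) (cong (m +_) (+-identityʳ m))

theorem4 : ∀ (k : ℕ) → 4 ≤ k →
    ∀ (g g′ : ℕ) → IsGamma k g → IsGamma (k ∸ 1) g′ →
    g ≤ (2 * k ∸ 2) * g′ + 6
theorem4 (suc m@(suc (suc _))) (s≤s 3≤m) _ g′ ((S , prim , refl) , _) (_ , bound) =
  subst (λ j → length S ≤ j * g′ + 6) (sym (2*[1+m]∸2 m))
    (primitive-length≤ 3≤m (bound (zero ∷ suc zero ∷ []) (pair-primitive λ ())) short prim)
  where
  short : ∀ {F : List (Fin (suc m))} {c} → SPrimitive F → c ∉ F → length F ≤ g′
  short {F} {c} primF c∉F with F′ , refl ← avoid⇒map-punchIn c F c∉F =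
    subst (_≤ g′) (sym (length-map (punchIn c) F′)) (bound F′ (primitive-map (punchIn c) primF))
theorem4 (suc zero) (s≤s ())
theorem4 (suc (suc zero)) (s≤s (s≤s ()))
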